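{- For every integer $n \geq 2$, let $G_n$ be the graph with vertex set $V(G_n) = \{u_0, \ldots, u_n\} \cup \{x_i, y_i, z_i : 1 \le i \le n-1\}$ (all these vertices distinct) and with exactly the following edges: $u_i u_{i+1}$ for $i \in \{0,\ldots,n-1\}$, and $u_i x_i$, $x_i y_i$, $y_i z_i$, $u_{i+1}x_i$, $u_{i+1}y_i$, $u_{i+1}z_i$ for $i \in \{1,\ldots,n-1\}$. Then $\gamma_{cg}'(G_n) = 2n$.
   Context: The connected domination game on a graph $G$ is played by two players, Dominator and Staller, who alternately select vertices. A vertex $w$ is a legal move if (a) its closed neighborhood $N[w]$ contains at least one vertex not in the union of the closed neighborhoods of the previously selected vertices (i.e. it dominates a new vertex), and (b) unless it is the first move, $w$ is adjacent to at least one already selected vertex. The game ends when no legal move exists; on a connected graph the selected vertices then form a connected dominating set. Dominator wants to minimize the total number of moves, Staller wants to maximize it. $\gamma_{cg}'(G)$ is the number of moves under optimal play when Staller moves first (S-game). -}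

module Defs where

open import Data.Fin.Base using (Fin; toℕ)
import Data.Fin.Properties as Fin
open import Data.List.Base using (List; []; _∷_; _++_; map; filter; length; allFin)
open import Data.List.Membership.Propositional using (_∈_; find; lose)
open import Data.List.Membership.Propositional.Properties using (∈-map⁺; ∈-++⁺ˡ; ∈-++⁺ʳ; ∈-allFin; ∈-filter⁻)
open import Data.List.NonEmpty.Base as List⁺ using (List⁺; foldr₁) renaming (_∷_ to _∷⁺_)
open import Data.List.Relation.Unary.Any using (Any; here; there; any?)
open import Data.Nat.Base using (ℕ; zero; suc; _∸_; _≤_; _<_; _⊓_; _⊔_; z≤n; s≤s; s≤s⁻¹)
open import Data.Nat.Properties using (≤-trans; m≤n⇒m≤1+n)
import Data.Nat.Properties as ℕ
open import Data.Product.Base using (∃-syntax; _×_; _,_; proj₂)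
open import Data.Sum.Base using (_⊎_; inj₁; inj₂)
open import Relation.Binary.Construct.Closure.Symmetric using (SymClosure; fwd; bwd; symmetric)
open import Relation.Binary.Definitions using (Decidable; DecidableEquality; Irreflexive; Symmetric)
open import Relation.Binary.PropositionalEquality using (_≡_; refl; cong; cong₂; sym)
import Relation.Unary as Unary
open import Relation.Nullary.Decidable using (Dec; yes; no; map′; ¬?; _×-dec_; _⊎-dec_)
open import Relation.Nullary.Negation using (¬_; contradiction)

record FiniteSimpleGraph : Set₁ where
  infix 4 _≟_ _~_ _~?_
  field
    Vertex   : Set
    _≟_      : DecidableEquality Vertex
    vertices : List Vertex
    complete : ∀ v → v ∈ vertices
    _~_      : Vertex → Vertex → Set
    _~?_     : Decidable _~_
    ~-sym    : Symmetric _~_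
    ~-irrefl : Irreflexive _≡_ _~_

data Player : Set where
  dominator staller : Player

other : Player → Player
other dominator = staller
other staller   = dominator

private
  module _ {A : Set} {P Q : A → Set} (P? : Unary.Decidable P) (Q? : Unary.Decidable Q) (P⊆Q : ∀ {v} → P v → Q v) where

    filter-≤ : ∀ vs → length (filter P? vs) ≤ length (filter Q? vs)
    filter-≤ []       = z≤n
    filter-≤ (v ∷ vs) with P? v | Q? v
    ... | yes _ | yes _ = s≤s (filter-≤ vs)
    ... | yes p | no ¬q = contradiction (P⊆Q p) ¬q
    ... | no  _ | yes _ = m≤n⇒m≤1+n (filter-≤ vs)
    ... | no  _ | no  _ = filter-≤ vs

    filter-< : ∀ {v₀} vs → v₀ ∈ vs → ¬ P v₀ → Q v₀ → length (filter P? vs) < length (filter Q? vs)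
    filter-< (v ∷ vs) (here refl) ¬p q with P? v | Q? v
    ... | yes p | _     = contradiction p ¬p
    ... | no  _ | yes _ = s≤s (filter-≤ vs)
    ... | no  _ | no ¬q = contradiction q ¬q
    filter-< (v ∷ vs) (there i) ¬p q with P? v | Q? v
    ... | yes _ | yes _ = s≤s (filter-< vs i ¬p q)
    ... | yes p | no ¬q = contradiction (P⊆Q p) ¬q
    ... | no  _ | yes _ = m≤n⇒m≤1+n (filter-< vs i ¬p q)
    ... | no  _ | no  _ = filter-< vs i ¬p q

module ConnectedDominationGame (G : FiniteSimpleGraph) where
  open FiniteSimpleGraph G

  -- A position is the list of the vertices selected so far, latest first.
  Position : Set
  Position = List Vertex

  infix 4 _∈N[_] _∈N[_]?

  _∈N[_] : Vertex → Vertex → Set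
  v ∈N[ w ] = v ≡ w ⊎ w ~ v

  Dominated : Position → Vertex → Set
  Dominated S v = Any (λ s → v ∈N[ s ]) S

  DominatesNew : Position → Vertex → Set
  DominatesNew S w = ∃[ v ] (v ∈N[ w ] × ¬ Dominated S v)

  Legal : Position → Vertex → Set
  Legal S w = DominatesNew S w × (S ≡ [] ⊎ Any (w ~_) S)

  _∈N[_]? : Decidable _∈N[_]
  v ∈N[ w ]? = (v ≟ w) ⊎-dec (w ~? v)

  dominated? : Decidable Dominated
  dominated? S v = any? (λ s → v ∈N[ s ]?) S

  dominatesNew? : Decidable DominatesNew
  dominatesNew? S w = map′
    (λ p → let (v , _ , q) = find p in v , q)
    (λ (v , q) → lose (complete v) q)
    (any? (λ v → (v ∈N[ w ]?) ×-dec ¬? (dominated? S v)) vertices)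

  empty? : (S : Position) → Dec (S ≡ [])
  empty? []      = yes refl
  empty? (_ ∷ _) = no λ ()

  legal? : Decidable Legal
  legal? S w = dominatesNew? S w ×-dec (empty? S ⊎-dec any? (w ~?_) S)

  legalMoves : Position → List Vertex
  legalMoves S = filter (legal? S) vertices

  best : Player → List⁺ ℕ → ℕ
  best dominator = foldr₁ _⊓_
  best staller   = foldr₁ _⊔_

  turn : Player → (Vertex → ℕ) → List Vertex → ℕ
  turn p value []       = 0
  turn p value (w ∷ ws) = suc (best p (List⁺.map value (w ∷⁺ ws)))

  -- The number of further moves under optimal play from S with p to move.  The
  -- ℕ argument only makes the recursion structural: every legal move dominates
  -- a new vertex, so once it is at least the number of undominated vertices
  -- its value is immaterial (movesLeft-stable below).
  movesLeft : ℕ → Player → Position → ℕ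
  movesLeft zero       p S = 0
  movesLeft (suc fuel) p S = turn p (λ w → movesLeft fuel (other p) (w ∷ S)) (legalMoves S)

  γcg′ : ℕ
  γcg′ = movesLeft (length vertices) staller []

  undominated : Position → List Vertex
  undominated S = filter (λ v → ¬? (dominated? S v)) vertices

  private
    map-cong-∈ : ∀ {f g : Vertex → ℕ} ws → (∀ {w} → w ∈ ws → f w ≡ g w) → map f ws ≡ map g ws
    map-cong-∈ []       eq = refl
    map-cong-∈ (w ∷ ws) eq = cong₂ _∷_ (eq (here refl)) (map-cong-∈ ws (λ i → eq (there i)))

    turn-cong : ∀ p {f g : Vertex → ℕ} ws → (∀ {w} → w ∈ ws → f w ≡ g w) → turn p f ws ≡ turn p g ws
    turn-cong p []       eq = refl
    turn-cong p (w ∷ ws) eq =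
      cong₂ (λ k ks → suc (best p (k ∷⁺ ks))) (eq (here refl)) (map-cong-∈ ws (λ i → eq (there i)))

  legal⇒shrinks : ∀ {S w} → Legal S w → length (undominated (w ∷ S)) < length (undominated S)
  legal⇒shrinks {S} {w} ((v , near , new) , _) =
    filter-< (λ v → ¬? (dominated? (w ∷ S) v)) (λ v → ¬? (dominated? S v)) (λ ¬d d → ¬d (there d))
      vertices (complete v) (λ ¬d → ¬d (here near)) new

  movesLeft-stable : ∀ fuel p S → length (undominated S) ≤ fuel →
    movesLeft (suc fuel) p S ≡ movesLeft fuel p S
  movesLeft-stable zero p S bound with legalMoves S in eq
  ... | []    = refl
  ... | w ∷ _ = contradiction (≤-trans (legal⇒shrinks w-legal) bound) λ ()
    where
    w-legal : Legal S w
    w-legal = proj₂ (∈-filter⁻ (legal? S) {xs = vertices} (≡-∈ (sym eq)))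
      where
      ≡-∈ : ∀ {vs ws} → w ∷ vs ≡ ws → w ∈ ws
      ≡-∈ refl = here refl
  movesLeft-stable (suc fuel) p S bound = turn-cong p (legalMoves S) λ {w} w∈ →
    movesLeft-stable fuel (other p) (w ∷ S)
      (s≤s⁻¹ (≤-trans (legal⇒shrinks (proj₂ (∈-filter⁻ (legal? S) {xs = vertices} w∈))) bound))

open ConnectedDominationGame public using (γcg′)

-- For k : Fin (n ∸ 1), the vertices x k, y k and z k carry the subscript
-- suc (toℕ k), which ranges over 1, …, n - 1.
data GVertex (n : ℕ) : Set where
  u     : Fin (suc n) → GVertex n
  x y z : Fin (n ∸ 1) → GVertex n

subscript : ∀ {m} → Fin m → ℕ
subscript k = suc (toℕ k)

infix 4 _—_ _—?_ _≟ᴳ_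

data _—_ {n : ℕ} : GVertex n → GVertex n → Set where
  uu  : ∀ {i j} → toℕ j ≡ suc (toℕ i)      → u i — u j
  ux  : ∀ {i k} → toℕ i ≡ subscript k       → u i — x k
  xy  : ∀ {k}                               → x k — y k
  yz  : ∀ {k}                               → y k — z k
  u⁺x : ∀ {j k} → toℕ j ≡ suc (subscript k) → u j — x k
  u⁺y : ∀ {j k} → toℕ j ≡ suc (subscript k) → u j — y k
  u⁺z : ∀ {j k} → toℕ j ≡ suc (subscript k) → u j — z k

_≟ᴳ_ : ∀ {n} → DecidableEquality (GVertex n)
u i ≟ᴳ u j = map′ (cong u) (λ { refl → refl }) (i Fin.≟ j)
u _ ≟ᴳ x _ = no λ ()
u _ ≟ᴳ y _ = no λ ()
u _ ≟ᴳ z _ = no λ ()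
x _ ≟ᴳ u _ = no λ ()
x k ≟ᴳ x l = map′ (cong x) (λ { refl → refl }) (k Fin.≟ l)
x _ ≟ᴳ y _ = no λ ()
x _ ≟ᴳ z _ = no λ ()
y _ ≟ᴳ u _ = no λ ()
y _ ≟ᴳ x _ = no λ ()
y k ≟ᴳ y l = map′ (cong y) (λ { refl → refl }) (k Fin.≟ l)
y _ ≟ᴳ z _ = no λ ()
z _ ≟ᴳ u _ = no λ ()
z _ ≟ᴳ x _ = no λ ()
z _ ≟ᴳ y _ = no λ ()
z k ≟ᴳ z l = map′ (cong z) (λ { refl → refl }) (k Fin.≟ l)

_—?_ : ∀ {n} → Decidable (_—_ {n})
u i —? u j = map′ uu (λ { (uu e) → e }) (toℕ j ℕ.≟ suc (toℕ i))
u i —? x k = map′ (λ { (inj₁ e) → ux e ; (inj₂ e) → u⁺x e }) (λ { (ux e) → inj₁ e ; (u⁺x e) → inj₂ e })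
                  ((toℕ i ℕ.≟ subscript k) ⊎-dec (toℕ i ℕ.≟ suc (subscript k)))
u j —? y k = map′ u⁺y (λ { (u⁺y e) → e }) (toℕ j ℕ.≟ suc (subscript k))
u j —? z k = map′ u⁺z (λ { (u⁺z e) → e }) (toℕ j ℕ.≟ suc (subscript k))
x k —? y l = map′ (λ { refl → xy }) (λ { xy → refl }) (k Fin.≟ l)
y k —? z l = map′ (λ { refl → yz }) (λ { yz → refl }) (k Fin.≟ l)
x _ —? u _ = no λ ()
x _ —? x _ = no λ ()
x _ —? z _ = no λ ()
y _ —? u _ = no λ ()
y _ —? x _ = no λ ()
y _ —? y _ = no λ ()
z _ —? u _ = no λ ()
z _ —? x _ = no λ ()
z _ —? y _ = no λ ()
z _ —? z _ = no λ ()

—-irrefl : ∀ {n} {v : GVertex n} → ¬ (v — v)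
—-irrefl (uu e) = ℕ.1+n≢n (sym e)

vertexList : ∀ n → List (GVertex n)
vertexList n = map u (allFin (suc n)) ++ map x (allFin (n ∸ 1)) ++ map y (allFin (n ∸ 1)) ++ map z (allFin (n ∸ 1))

∈-vertexList : ∀ {n} (v : GVertex n) → v ∈ vertexList n
∈-vertexList {n} (u i) = ∈-++⁺ˡ (∈-map⁺ u (∈-allFin i))
∈-vertexList {n} (x k) = ∈-++⁺ʳ (map u (allFin (suc n))) (∈-++⁺ˡ (∈-map⁺ x (∈-allFin k)))
∈-vertexList {n} (y k) = ∈-++⁺ʳ (map u (allFin (suc n))) (∈-++⁺ʳ (map x (allFin (n ∸ 1)))
  (∈-++⁺ˡ (∈-map⁺ y (∈-allFin k))))
∈-vertexList {n} (z k) = ∈-++⁺ʳ (map u (allFin (suc n))) (∈-++⁺ʳ (map x (allFin (n ∸ 1)))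
  (∈-++⁺ʳ (map y (allFin (n ∸ 1))) (∈-map⁺ z (∈-allFin k))))

Gₙ : ℕ → FiniteSimpleGraph
Gₙ n = record
  { Vertex   = GVertex n
  ; _≟_      = _≟ᴳ_
  ; vertices = vertexList n
  ; complete = ∈-vertexList
  ; _~_      = SymClosure _—_
  ; _~?_     = λ v w → map′ (λ { (inj₁ e) → fwd e ; (inj₂ e) → bwd e })
                            (λ { (fwd e) → inj₁ e ; (bwd e) → inj₂ e })
                            ((v —? w) ⊎-dec (w —? v))
  ; ~-sym    = symmetric _—_
  ; ~-irrefl = λ { refl (fwd e) → —-irrefl e ; refl (bwd e) → —-irrefl e }
  }

{-# OPTIONS --safe #-}

-- Give u k rank k and x k, y k, z k rank k + 1.  If the selected vertices include
-- u i, …, u j and all have ranks between i and j, then only u (i - 1), u (j + 1) and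
-- x j can be legal.  Always moving to u (j + 1), Dominator keeps the number of further
-- moves down to 2 (n - j) + i with Staller to move, and one less on his own turn as
-- long as j < n; Staller's move x j costs him nothing, since u (j + 1) makes up for it.
-- Conversely Staller opens with u 0, which forces u 1 and leaves no moves to the left.
-- She then secures 2 (n - j) moves on her turn and one less on Dominator's: she plays
-- x j herself, and after x j by Dominator, or y j in answer to her own x j, she moves
-- on to u (j + 1).
module Submission where

open import Defs
open import Data.Fin.Base using (Fin; zero; suc; toℕ; fromℕ<)
open import Data.Fin.Properties using (toℕ<n; toℕ≤pred[n]; toℕ-fromℕ<; toℕ-injective)
open import Data.List.Base using ([]; _∷_; _++_; map; length; allFin)
open import Data.List.Membership.Propositional using (_∈_; find; lose)
open import Data.List.Membership.Propositional.Properties using (∈-map⁺; ∈-map⁻; ∈-++⁺ʳ; ∈-++⁻; ∈-filter⁺; ∈-filter⁻)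
open import Data.List.NonEmpty.Base renaming (_∷_ to _∷⁺_) using ()
open import Data.List.Properties using (length-++; length-map; length-tabulate)
open import Data.List.Relation.Unary.All as All using (All; []; _∷_)
open import Data.List.Relation.Unary.Any using (Any; here; there)
open import Data.Nat using (ℕ; zero; suc; _+_; _*_; _∸_; _≤_; _<_; z≤n; s≤s; s≤s⁻¹)
open import Data.Nat.Properties
open import Data.Nat.Solver using (module +-*-Solver)
open import Data.Product.Base using (∃-syntax; Σ-syntax; _×_; _,_; proj₁; proj₂)
open import Data.Sum.Base using (inj₁; inj₂)
open import Function.Base using (_∘_; id)
open import Relation.Binary.Construct.Closure.Symmetric using (fwd; bwd)
open import Relation.Binary.PropositionalEquality using (_≡_; refl; sym; trans; cong; cong₂; subst)
open import Relation.Nullary using (¬_; contradiction)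

open +-*-Solver using (solve; con; _:+_; _:*_; _:=_)

-- Bounding game values by strategies, on an arbitrary graph.

module Bounds (G : FiniteSimpleGraph) where
  open FiniteSimpleGraph G
  open ConnectedDominationGame G hiding (γcg′)

  best-∈ : ∀ p k ks → best p (k ∷⁺ ks) ∈ k ∷ ks
  best-∈ dominator k []       = here refl
  best-∈ staller   k []       = here refl
  best-∈ dominator k (l ∷ ks) with ⊓-sel k (best dominator (l ∷⁺ ks))
  ... | inj₁ eq = here eq
  ... | inj₂ eq = there (subst (_∈ l ∷ ks) (sym eq) (best-∈ dominator l ks))
  best-∈ staller k (l ∷ ks) with ⊔-sel k (best staller (l ∷⁺ ks))
  ... | inj₁ eq = here eq
  ... | inj₂ eq = there (subst (_∈ l ∷ ks) (sym eq) (best-∈ staller l ks))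

  best-minimal : ∀ {l} k ks → l ∈ k ∷ ks → best dominator (k ∷⁺ ks) ≤ l
  best-minimal k []       (here refl) = ≤-refl
  best-minimal k (m ∷ ks) (here refl) = m⊓n≤m k _
  best-minimal k (m ∷ ks) (there l∈)  = ≤-trans (m⊓n≤n k _) (best-minimal m ks l∈)

  best-maximal : ∀ {l} k ks → l ∈ k ∷ ks → l ≤ best staller (k ∷⁺ ks)
  best-maximal k []       (here refl) = ≤-refl
  best-maximal k (m ∷ ks) (here refl) = m≤m⊔n k _
  best-maximal k (m ∷ ks) (there l∈)  = ≤-trans (best-maximal m ks l∈) (m≤n⊔m k _)

  module _ (value : Vertex → ℕ) where

    turn-minimal : ∀ ws {w} → w ∈ ws → turn dominator value ws ≤ suc (value w)
    turn-minimal (w ∷ ws) w∈ = s≤s (best-minimal (value w) (map value ws) (∈-map⁺ value w∈))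

    turn-maximal : ∀ ws {w} → w ∈ ws → suc (value w) ≤ turn staller value ws
    turn-maximal (w ∷ ws) w∈ = s≤s (best-maximal (value w) (map value ws) (∈-map⁺ value w∈))

    turn-attained : ∀ p ws {w} → w ∈ ws → ∃[ w′ ] (w′ ∈ ws × turn p value ws ≡ suc (value w′))
    turn-attained p (w ∷ ws) _ =
      let w′ , w′∈ , eq = ∈-map⁻ value (best-∈ p (value w) (map value ws)) in w′ , w′∈ , cong suc eq

  Legal⇒∈ : ∀ {S w} → Legal S w → w ∈ legalMoves S
  Legal⇒∈ {S} {w} = ∈-filter⁺ (legal? S) (complete w)

  ∈⇒Legal : ∀ {S w} → w ∈ legalMoves S → Legal S w
  ∈⇒Legal {S} = proj₂ ∘ ∈-filter⁻ (legal? S) {xs = vertices}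

  -- An optimal value is attained at some legal move, so a bound over all moves serves either
  -- player; it is strict to leave room for the move itself. A finished game has value 0.
  all-replies-≤ : ∀ f {p S B} → (∀ {w} → Legal S w → movesLeft f (other p) (w ∷ S) < B) →
    movesLeft (suc f) p S ≤ B
  all-replies-≤ f {p} {S} bound with legalMoves S in eq
  ... | []     = z≤n
  ... | v ∷ vs =
    let w , w∈ , value = turn-attained (λ w → movesLeft f (other p) (w ∷ S)) p (v ∷ vs) (here refl)
    in ≤-trans (≤-reflexive value) (bound (∈⇒Legal (subst (w ∈_) (sym eq) w∈)))

  dominator-plays : ∀ f {S w B} → Legal S w → movesLeft f staller (w ∷ S) ≤ B →
    movesLeft (suc f) dominator S ≤ suc B
  dominator-plays f {S} legal bound =
    ≤-trans (turn-minimal (λ w → movesLeft f staller (w ∷ S)) (legalMoves S) (Legal⇒∈ legal)) (s≤s bound)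

  staller-plays : ∀ f {S w b} → Legal S w → b ≤ movesLeft f dominator (w ∷ S) →
    suc b ≤ movesLeft (suc f) staller S
  staller-plays f {S} legal bound =
    ≤-trans (s≤s bound) (turn-maximal (λ w → movesLeft f dominator (w ∷ S)) (legalMoves S) (Legal⇒∈ legal))

  -- The given legal move only certifies that the game goes on; the bound itself must survive every
  -- move, as `p` may be the opponent.
  all-replies-≥ : ∀ f {p S w b} → Legal S w → (∀ {w} → Legal S w → b ≤ movesLeft f (other p) (w ∷ S)) →
    suc b ≤ movesLeft (suc f) p S
  all-replies-≥ f {p} {S} legal bound =
    let w , w∈ , value = turn-attained (λ w → movesLeft f (other p) (w ∷ S)) p (legalMoves S) (Legal⇒∈ legal)
    in subst (suc _ ≤_) (sym value) (s≤s (bound (∈⇒Legal w∈)))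

module _ {n : ℕ} where
  open FiniteSimpleGraph (Gₙ n) using (_~_)
  open ConnectedDominationGame (Gₙ n) hiding (γcg′)
  open Bounds (Gₙ n)

  -- Ranks, neighbourhoods and spans.

  rank : GVertex n → ℕ
  rank (u k) = toℕ k
  rank (x l) = suc (subscript l)
  rank (y l) = suc (subscript l)
  rank (z l) = suc (subscript l)

  fin-u : ∀ {j m} → j + m ≡ n → Σ[ k ∈ Fin (suc n) ] toℕ k ≡ j
  fin-u j+m≡n = let j<1+n = s≤s (m+n≤o⇒m≤o _ (≤-reflexive j+m≡n)) in fromℕ< j<1+n , toℕ-fromℕ< j<1+n

  -- In equations like `j + m ≡ n`, `m` counts the spine vertices to the right of `u j`. A tip
  -- carries a gadget when it is neither `u 0` nor `u n`, hence the two successors.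
  fin-gadget : ∀ {j m} → suc j + suc m ≡ n → Σ[ l ∈ Fin (n ∸ 1) ] subscript l ≡ suc j
  fin-gadget {j} {m} refl = let j< = m<m+n j {suc m} (s≤s z≤n) in fromℕ< j< , cong suc (toℕ-fromℕ< j<)

  gadget-below : ∀ (l : Fin (n ∸ 1)) → suc (subscript l) < suc n
  gadget-below l = s≤s (m<n∸1⇒ n (toℕ<n l))
    where
    m<n∸1⇒ : ∀ {m} n → m < n ∸ 1 → suc (suc m) ≤ n
    m<n∸1⇒ (suc n) m<n = s≤s m<n

  spine-vertex : ∀ w → Σ[ k ∈ Fin (suc n) ] toℕ k ≡ rank w
  spine-vertex (u k) = k , refl
  spine-vertex (x l) = fromℕ< (gadget-below l) , toℕ-fromℕ< (gadget-below l)
  spine-vertex (y l) = fromℕ< (gadget-below l) , toℕ-fromℕ< (gadget-below l)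
  spine-vertex (z l) = fromℕ< (gadget-below l) , toℕ-fromℕ< (gadget-below l)

  same-u : ∀ {k l : Fin (suc n)} → toℕ k ≡ toℕ l → u {n} k ≡ u l
  same-u = cong u ∘ toℕ-injective

  -- `u (i + 1)` sees all of the gadget `x i`, `y i`, `z i`, and the only other neighbour of that
  -- gadget is `u i`, the preceding spine vertex.
  spine-covers : ∀ w {k v} → toℕ k ≡ rank w → v ∈N[ w ] → v ∈N[ u k ]
  spine-covers (u _) e near rewrite toℕ-injective e = near
  spine-covers (x _) e (inj₁ refl)             = inj₂ (fwd (u⁺x e))
  spine-covers (x _) e (inj₂ (fwd xy))         = inj₂ (fwd (u⁺y e))
  spine-covers (x _) e (inj₂ (bwd (ux e′)))    = inj₂ (bwd (uu (trans e (cong suc (sym e′)))))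
  spine-covers (x _) e (inj₂ (bwd (u⁺x e′)))   = inj₁ (same-u (trans e′ (sym e)))
  spine-covers (y _) e (inj₁ refl)             = inj₂ (fwd (u⁺y e))
  spine-covers (y _) e (inj₂ (fwd yz))         = inj₂ (fwd (u⁺z e))
  spine-covers (y _) e (inj₂ (bwd xy))         = inj₂ (fwd (u⁺x e))
  spine-covers (y _) e (inj₂ (bwd (u⁺y e′)))   = inj₁ (same-u (trans e′ (sym e)))
  spine-covers (z _) e (inj₁ refl)             = inj₂ (fwd (u⁺z e))
  spine-covers (z _) e (inj₂ (bwd yz))         = inj₂ (fwd (u⁺y e))
  spine-covers (z _) e (inj₂ (bwd (u⁺z e′)))   = inj₁ (same-u (trans e′ (sym e)))

  rank-near : ∀ {v w} → v ∈N[ w ] → rank v ≤ suc (rank w)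
  rank-near (inj₁ refl)              = n≤1+n _
  rank-near (inj₂ (fwd (uu e)))      = ≤-reflexive e
  rank-near (inj₂ (fwd (ux e)))      = ≤-reflexive (cong suc (sym e))
  rank-near (inj₂ (fwd xy))          = n≤1+n _
  rank-near (inj₂ (fwd yz))          = n≤1+n _
  rank-near (inj₂ (fwd (u⁺x e)))     = m≤n⇒m≤1+n (≤-reflexive (sym e))
  rank-near (inj₂ (fwd (u⁺y e)))     = m≤n⇒m≤1+n (≤-reflexive (sym e))
  rank-near (inj₂ (fwd (u⁺z e)))     = m≤n⇒m≤1+n (≤-reflexive (sym e))
  rank-near (inj₂ (bwd (uu e)))      = m≤n⇒m≤1+n (≤-trans (n≤1+n _) (≤-reflexive (sym e)))
  rank-near (inj₂ (bwd (ux e)))      = m≤n⇒m≤1+n (m≤n⇒m≤1+n (≤-reflexive e))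
  rank-near (inj₂ (bwd xy))          = n≤1+n _
  rank-near (inj₂ (bwd yz))          = n≤1+n _
  rank-near (inj₂ (bwd (u⁺x e)))     = m≤n⇒m≤1+n (≤-reflexive e)
  rank-near (inj₂ (bwd (u⁺y e)))     = m≤n⇒m≤1+n (≤-reflexive e)
  rank-near (inj₂ (bwd (u⁺z e)))     = m≤n⇒m≤1+n (≤-reflexive e)

  -- Unlike `x l`, neither `y l` nor `z l` is adjacent to the spine vertex at its own subscript.
  -- Both therefore stay undominated until rank `suc (subscript l)` is reached, and so can witness
  -- legality at the tip.
  rank-near-y : ∀ {l w} → y l ∈N[ w ] → rank w ≡ suc (subscript l)
  rank-near-y (inj₁ refl)          = refl
  rank-near-y (inj₂ (fwd xy))      = refl
  rank-near-y (inj₂ (fwd (u⁺y e))) = e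
  rank-near-y (inj₂ (bwd yz))      = refl

  rank-near-z : ∀ {l w} → z l ∈N[ w ] → rank w ≡ suc (subscript l)
  rank-near-z (inj₁ refl)          = refl
  rank-near-z (inj₂ (fwd yz))      = refl
  rank-near-z (inj₂ (fwd (u⁺z e))) = e

  -- The block u i, …, u j then dominates the closed neighbourhood of every vertex
  -- of rank between i and j, so no such vertex is a legal move.
  record Span (i j : ℕ) (S : Position) : Set where
    field
      ordered : i ≤ j
      spine   : ∀ k → i ≤ toℕ k → toℕ k ≤ j → u k ∈ S
      ranks   : ∀ {s} → s ∈ S → i ≤ rank s × rank s ≤ j

  open Span

  Span-singleton : ∀ k → Span (toℕ k) (toℕ k) (u k ∷ [])
  Span-singleton k .ordered = ≤-refl
  Span-singleton k .spine l k≤l l≤k = here (same-u (≤-antisym l≤k k≤l))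
  Span-singleton k .ranks (here refl) = ≤-refl , ≤-refl

  -- Describes the position after an opening inside a gadget answered by the spine vertex of the
  -- same rank.
  Span-pair : ∀ {i k w} → toℕ k ≡ i → rank w ≡ i → Span i i (u k ∷ w ∷ [])
  Span-pair k≡i w≡i .ordered = ≤-refl
  Span-pair k≡i w≡i .spine l i≤l l≤i = here (same-u (trans (≤-antisym l≤i i≤l) (sym k≡i)))
  Span-pair k≡i w≡i .ranks (here refl)         = ≤-reflexive (sym k≡i) , ≤-reflexive k≡i
  Span-pair k≡i w≡i .ranks (there (here refl)) = ≤-reflexive (sym w≡i) , ≤-reflexive w≡i

  extend-left : ∀ {i j k S} → suc (toℕ k) ≡ i → Span i j S → Span (toℕ k) j (u k ∷ S)
  extend-left refl σ .ordered = <⇒≤ (ordered σ)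
  extend-left {k = k} refl σ .spine l k≤l l≤j with m≤n⇒m<n∨m≡n k≤l
  ... | inj₁ k<l = there (spine σ l k<l l≤j)
  ... | inj₂ k≡l = here (same-u (sym k≡l))
  extend-left refl σ .ranks (here refl) = ≤-refl , <⇒≤ (ordered σ)
  extend-left refl σ .ranks (there s∈)  = let lo , hi = ranks σ s∈ in <⇒≤ lo , hi

  -- `ws` holds the gadget vertices played since the last spine move; they have the rank of the new
  -- tip, so the whole exchange is absorbed at once.
  extend-right : ∀ {i j k S} ws → All (λ w → rank w ≡ suc j) ws → toℕ k ≡ suc j →
    Span i j S → Span i (suc j) (u k ∷ ws ++ S)
  extend-right ws top e σ .ordered = m≤n⇒m≤1+n (ordered σ)
  extend-right ws top e σ .spine l i≤l l≤1+j with m≤n⇒m<n∨m≡n l≤1+j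
  ... | inj₁ l<1+j = there (∈-++⁺ʳ ws (spine σ l i≤l (s≤s⁻¹ l<1+j)))
  ... | inj₂ l≡1+j = here (same-u (trans l≡1+j (sym e)))
  extend-right ws top e σ .ranks (here refl) =
    ≤-trans (m≤n⇒m≤1+n (ordered σ)) (≤-reflexive (sym e)) , ≤-reflexive e
  extend-right ws top e σ .ranks (there s∈) with ∈-++⁻ ws s∈
  ... | inj₁ s∈ws = let t = All.lookup top s∈ws in
    ≤-trans (m≤n⇒m≤1+n (ordered σ)) (≤-reflexive (sym t)) , ≤-reflexive t
  ... | inj₂ s∈S  = let lo , hi = ranks σ s∈S in lo , m≤n⇒m≤1+n hi

  -- Legal moves around a span.

  data Frontier (i j : ℕ) : GVertex n → Set where
    left  : ∀ {k} → suc (toℕ k) ≡ i → Frontier i j (u k)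
    right : ∀ {k} → toℕ k ≡ suc j → Frontier i j (u k)
    probe : ∀ {l} → subscript l ≡ j → Frontier i j (x l)

  module _ {i j S} (σ : Span i j S) where

    span-dominates : ∀ {w v} → i ≤ rank w → rank w ≤ j → v ∈N[ w ] → Dominated S v
    span-dominates {w} i≤w w≤j near =
      let k , e = spine-vertex w
      in lose (spine σ k (subst (i ≤_) (sym e) i≤w) (subst (_≤ j) (sym e) w≤j)) (spine-covers w e near)

    -- An edge changes the rank by at most one, so `w` can leave the range only by stepping down
    -- from rank `i` or up from rank `j`. Edges within one rank cannot leave it.
    frontier : ∀ {s w} → s ∈ S → w ~ s → ¬ (i ≤ rank w × rank w ≤ j) → Frontier i j w
    frontier {s} {w} s∈ w~s out = classify w~s
      where
      level : ∀ {A : Set} → rank w ≡ rank s → A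
      level e = contradiction (subst (λ r → i ≤ r × r ≤ j) (sym e) (ranks σ s∈)) out
      below : rank s ≡ suc (rank w) → suc (rank w) ≡ i
      below e with ranks σ s∈
      ... | lo , hi with m≤n⇒m<n∨m≡n (≤-trans lo (≤-reflexive e))
      ...   | inj₁ i≤w = contradiction (s≤s⁻¹ i≤w , <⇒≤ (≤-trans (≤-reflexive (sym e)) hi)) out
      ...   | inj₂ i≡  = sym i≡
      above : rank w ≡ suc (rank s) → rank w ≡ suc j
      above e with ranks σ s∈
      ... | lo , hi with m≤n⇒m<n∨m≡n hi
      ...   | inj₁ s<j = contradiction
                (≤-trans (m≤n⇒m≤1+n lo) (≤-reflexive (sym e)) , ≤-trans (≤-reflexive e) s<j) out
      ...   | inj₂ s≡j = trans e (cong suc s≡j)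
      classify : w ~ s → Frontier i j w
      classify (fwd (uu e))  = left (below e)
      classify (fwd (ux e))  = left (below (cong suc (sym e)))
      classify (fwd xy)      = level refl
      classify (fwd yz)      = level refl
      classify (fwd (u⁺x e)) = level e
      classify (fwd (u⁺y e)) = level e
      classify (fwd (u⁺z e)) = level e
      classify (bwd (uu e))  = right (above e)
      classify (bwd (ux e))  = probe (suc-injective (above (cong suc (sym e))))
      classify (bwd xy)      = level refl
      classify (bwd yz)      = level refl
      classify (bwd (u⁺x e)) = level (sym e)
      classify (bwd (u⁺y e)) = level (sym e)
      classify (bwd (u⁺z e)) = level (sym e)

    tip : ∀ {m} → j + m ≡ n → Σ[ k ∈ Fin (suc n) ] (toℕ k ≡ j × u k ∈ S)
    tip j+m≡n =
      let k , e = fin-u j+m≡n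
      in k , e , spine σ k (≤-trans (ordered σ) (≤-reflexive (sym e))) (≤-reflexive e)

    -- A move inside the rank range dominates nothing new. The converse fails: with `i` equal to 1,
    -- `u 0` is on the frontier but illegal.
    legal-moves : ∀ {m w} → j + m ≡ n → Legal S w → Frontier i j w
    legal-moves j+m≡n (_ , inj₁ refl) = let _ , _ , ∈[] = tip j+m≡n in contradiction ∈[] λ ()
    legal-moves j+m≡n ((_ , near , new) , inj₂ adjacent) =
      let _ , s∈ , w~s = find adjacent
      in frontier s∈ w~s λ (lo , hi) → new (span-dominates lo hi near)

    fresh-y : ∀ {l} → subscript l ≡ j → ¬ Dominated S (y l)
    fresh-y refl d = let _ , s∈ , near = find d in
      n≮n _ (≤-trans (≤-reflexive (sym (rank-near-y near))) (proj₂ (ranks σ s∈)))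

    fresh-z : ∀ {l} → subscript l ≡ j → ¬ Dominated S (z l)
    fresh-z refl d = let _ , s∈ , near = find d in
      n≮n _ (≤-trans (≤-reflexive (sym (rank-near-z near))) (proj₂ (ranks σ s∈)))

    fresh-u : ∀ {k} → toℕ k ≡ suc (suc j) → ¬ Dominated S (u k)
    fresh-u e d = let _ , s∈ , near = find d in
      n≮n _ (≤-trans (≤-reflexive (sym e)) (≤-trans (rank-near near) (s≤s (proj₂ (ranks σ s∈)))))

    beside-tip : ∀ {m k} → j + m ≡ n → toℕ k ≡ suc j → Any (u k ~_) S
    beside-tip j+m≡n e =
      let _ , e′ , t∈ = tip j+m≡n in lose t∈ (bwd (uu (trans e (cong suc (sym e′)))))

    probe-legal : ∀ {m l} → j + m ≡ n → subscript l ≡ j → Legal S (x l)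
    probe-legal {l = l} j+m≡n e =
      let _ , e′ , t∈ = tip j+m≡n
      in (y l , inj₂ (fwd xy) , fresh-y e) , inj₂ (lose t∈ (bwd (ux (trans e′ (sym e)))))

    right-legal : ∀ {m k l} → j + m ≡ n → toℕ k ≡ suc j → subscript l ≡ j → Legal S (u k)
    right-legal {l = l} j+m≡n e e′ =
      (z l , inj₂ (fwd (u⁺z (trans e (cong suc (sym e′))))) , fresh-z e′) , inj₂ (beside-tip j+m≡n e)

    right-legal-x : ∀ {m k l} → j + m ≡ n → toℕ k ≡ suc j → subscript l ≡ j → Legal (x l ∷ S) (u k)
    right-legal-x {l = l} j+m≡n e e′ =
      (z l , inj₂ (fwd (u⁺z (trans e (cong suc (sym e′))))) , undominated-z) ,
      inj₂ (there (beside-tip j+m≡n e))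
      where
      undominated-z : ¬ Dominated (x l ∷ S) (z l)
      undominated-z (here (inj₂ (fwd ())))
      undominated-z (here (inj₂ (bwd ())))
      undominated-z (there d) = fresh-z e′ d

    -- After `x l` and `y l` the whole gadget is dominated, so the new vertex has to be `u (j + 2)`.
    -- This is why two spine vertices must remain beyond `u j`.
    right-legal-yx : ∀ {m k l} → j + suc (suc m) ≡ n → toℕ k ≡ suc j → subscript l ≡ j →
      Legal (y l ∷ x l ∷ S) (u k)
    right-legal-yx {m} {k} {l} j+m≡n e refl =
      (u k′ , inj₂ (fwd (uu (trans e′ (cong suc (sym e))))) , undominated-u) ,
      inj₂ (there (there (beside-tip j+m≡n e)))
      where
      k′e′ = fin-u {m = m} (trans (sym (trans (+-suc j (suc m)) (cong suc (+-suc j m)))) j+m≡n)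
      k′ = proj₁ k′e′
      e′ = proj₂ k′e′
      undominated-u : ¬ Dominated (y l ∷ x l ∷ S) (u k′)
      undominated-u (here (inj₂ (bwd (u⁺y e″))))        = 1+n≢n (trans (sym e′) e″)
      undominated-u (there (here (inj₂ (bwd (ux e″))))) = <⇒≢ (m<n+m _ {2} (s≤s z≤n)) (trans (sym e″) e′)
      undominated-u (there (here (inj₂ (bwd (u⁺x e″))))) = 1+n≢n (trans (sym e′) e″)
      undominated-u (there (there d)) = fresh-u e′ d

  data Reply (j : ℕ) (l : Fin (n ∸ 1)) : GVertex n → Set where
    right : ∀ {k} → toℕ k ≡ suc j → Reply j l (u k)
    stay  : Reply j l (y l)

  replies-to-probe : ∀ {j l S w} → Span 0 j S → subscript l ≡ j → Legal (x l ∷ S) w → Reply j l w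
  replies-to-probe {j} {l} {S} {w} σ e ((v , near , new) , inj₂ adjacent) = reply adjacent
    where
    out : ¬ (0 ≤ rank w × rank w ≤ j)
    out (lo , hi) = new (there (span-dominates σ lo hi near))
    from-frontier : Frontier 0 j w → Reply j l w
    from-frontier (right e′) = right e′
    -- Subscripts are injective, so this probe would be the already selected `x l`.
    from-frontier (probe e′) with toℕ-injective (suc-injective (trans e′ (sym e)))
    ... | refl = contradiction (here near) new
    reply : Any (w ~_) (x l ∷ S) → Reply j l w
    reply (here (fwd (ux e′)))  = contradiction (z≤n , ≤-reflexive (trans e′ e)) out
    reply (here (fwd (u⁺x e′))) = right (trans e′ (cong suc e))
    reply (here (bwd xy))       = stay
    reply (there a)             = let _ , s∈ , w~s = find a in from-frontier (frontier σ s∈ w~s out)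

  -- Dominator's strategy from a span.

  shift : ∀ j m → j + suc m ≡ n → suc j + m ≡ n
  shift j m = trans (sym (+-suc j m))

  no-right : ∀ {j} {k : Fin (suc n)} → j + 0 ≡ n → ¬ toℕ k ≡ suc j
  no-right {j} {k} e e′ = n≮n j (≤-trans (≤-reflexive (sym e′))
    (≤-trans (toℕ≤pred[n] k) (≤-reflexive (trans (sym e) (+-identityʳ j)))))

  no-probe : ∀ {j} {l : Fin (n ∸ 1)} → j + 0 ≡ n → ¬ subscript l ≡ j
  no-probe {l = l} e e′ = let k , e″ = spine-vertex (x l) in no-right e (trans e″ (cong suc e′))

  -- Each spine vertex on the right is charged two moves and each on the left one. The tip is
  -- `suc j` because `u 0` has no gadget to make the step right legal. Truncation in `m * 2 ∸ 1`
  -- leaves just `i` when the right side is exhausted.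
  upper-staller : ∀ f {i j} m {S} → Span i (suc j) S → suc j + m ≡ n → movesLeft f staller S ≤ m * 2 + i
  upper-dominator : ∀ f {i j} m {S} → Span i (suc j) S → suc j + m ≡ n →
    movesLeft f dominator S ≤ (m * 2 ∸ 1) + i

  upper-staller zero m σ e = z≤n
  upper-staller (suc f) {i} {j} m {S} σ e = all-replies-≤ f λ legal → reply m e (legal-moves σ e legal)
    where
    reply : ∀ m {w} → suc j + m ≡ n → Frontier i (suc j) w → movesLeft f dominator (w ∷ S) < m * 2 + i
    reply m e (left {k} refl) = ≤-trans
      (s≤s (≤-trans (upper-dominator f m (extend-left refl σ) e) (+-monoˡ-≤ (toℕ k) (m∸n≤m (m * 2) 1))))
      (≤-reflexive (sym (+-suc (m * 2) (toℕ k))))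
    reply zero e (right e′) = contradiction e′ (no-right e)
    reply zero e (probe e′) = contradiction e′ (no-probe e)
    reply (suc m) e (right e′) =
      s≤s (≤-trans (upper-dominator f m (extend-right [] [] e′ σ) (shift (suc j) m e))
        (≤-trans (+-monoˡ-≤ i (m∸n≤m (m * 2) 1)) (n≤1+n _)))
    reply (suc m) e (probe e′) = s≤s (after f)
      where
      ke = fin-u (shift (suc j) m e)
      -- The probe and its answer together use the two moves charged to the new spine vertex. The
      -- fuel may run out between them, leaving value 0.
      after : ∀ f → movesLeft f dominator (x _ ∷ S) ≤ suc (m * 2 + i)
      after zero    = z≤n
      after (suc f) = dominator-plays f (right-legal-x σ e (proj₂ ke) e′)
        (upper-staller f m (extend-right (x _ ∷ []) (cong suc e′ ∷ []) (proj₂ ke) σ) (shift (suc j) m e))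

  upper-dominator zero m σ e = z≤n
  upper-dominator (suc f) {j = j} (suc m) σ e =
    let _ , e₁ = fin-u (shift (suc j) m e)
        _ , e₂ = fin-gadget e
    in dominator-plays f (right-legal σ e e₁ e₂) (upper-staller f m (extend-right [] [] e₁ σ) (shift (suc j) m e))
  -- With nothing on the right, even Dominator can only move left, and each such move lowers `i`.
  upper-dominator (suc f) {i} {j} zero {S} σ e = all-replies-≤ f λ legal → reply (legal-moves σ e legal)
    where
    reply : ∀ {w} → Frontier i (suc j) w → movesLeft f staller (w ∷ S) < i
    reply (left refl) = s≤s (upper-staller f 0 (extend-left refl σ) e)
    reply (right e′)  = contradiction e′ (no-right e)
    reply (probe e′)  = contradiction e′ (no-probe e)

  -- Staller's strategy from a span.

  -- The left end 0 rules out moves to the left. The fuel exceeds the claimed number of moves by an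
  -- arbitrary `e`, so it cannot run out before they are counted.
  lower-staller : ∀ m {e j S} → Span 0 (suc j) S → suc j + m ≡ n →
    m * 2 ≤ movesLeft (m * 2 + e) staller S
  lower-dominator : ∀ m {e j S} → Span 0 (suc j) S → suc j + suc m ≡ n →
    suc (m * 2) ≤ movesLeft (suc (m * 2 + e)) dominator S

  lower-staller zero σ eq = z≤n
  lower-staller (suc m) {e} {j} {S} σ eq = staller-plays (suc (m * 2 + e)) (probe-legal σ eq e₂)
    (all-replies-≥ (m * 2 + e) (right-legal-x σ eq e₁ e₂) λ legal → respond m eq (replies-to-probe σ e₂ legal))
    where
    ke = fin-u (shift (suc j) m eq)
    le = fin-gadget eq
    l  = proj₁ le
    e₁ = proj₂ ke
    e₂ = proj₂ le
    respond : ∀ m {w} → suc j + suc m ≡ n → Reply (suc j) l w →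
      m * 2 ≤ movesLeft (m * 2 + e) staller (w ∷ x l ∷ S)
    respond m eq (right e′) = lower-staller m (extend-right (x _ ∷ []) (cong suc e₂ ∷ []) e′ σ) (shift (suc j) m eq)
    -- The tip was `u (n - 1)`: the moves `x l` and `y l` already make up the two required.
    respond zero eq stay = z≤n
    -- Three moves for one spine step hand the turn to Dominator; the extra move offsets his bound
    -- being one lower.
    respond (suc m) eq stay = staller-plays (suc (m * 2 + e)) (right-legal-yx σ eq e₁ e₂)
      (lower-dominator m (extend-right (y l ∷ x l ∷ []) (cong suc e₂ ∷ cong suc e₂ ∷ []) e₁ σ) (shift (suc j) (suc m) eq))

  lower-dominator m {e} {j} {S} σ eq =
    all-replies-≥ (m * 2 + e) (right-legal σ eq (proj₂ ke) (proj₂ (fin-gadget eq)))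
      λ legal → respond m eq (legal-moves σ eq legal)
    where
    ke = fin-u (shift (suc j) m eq)
    respond : ∀ m {w} → suc j + suc m ≡ n → Frontier 0 (suc j) w →
      m * 2 ≤ movesLeft (m * 2 + e) staller (w ∷ S)
    respond m eq (right e′) = lower-staller m (extend-right [] [] e′ σ) (shift (suc j) m eq)
    respond zero eq (probe e′) = z≤n
    -- Two moves for one spine step, and Dominator is to move again.
    respond (suc m) eq (probe e′) = staller-plays (suc (m * 2 + e)) (right-legal-x σ eq (proj₂ ke) e′)
      (lower-dominator m (extend-right (x _ ∷ []) (cong suc e′ ∷ []) (proj₂ ke) σ) (shift (suc j) (suc m) eq))

  -- Opening moves.

  -- No gadget has subscript 0, so `right-legal` cannot be applied at `u 0`; the newly dominated
  -- vertex is `u 2`, which exists by `2 ≤ n`.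
  second-move-legal : ∀ {k} → 2 ≤ n → toℕ k ≡ 1 → Legal (u zero ∷ []) (u k)
  second-move-legal 2≤n k≡1 =
    let at-2 = toℕ-fromℕ< (s≤s 2≤n)
    in (u (fromℕ< (s≤s 2≤n)) , inj₂ (fwd (uu (trans at-2 (cong suc (sym k≡1))))) ,
        fresh-u (Span-singleton zero) at-2) ,
       inj₂ (here (bwd (uu k≡1)))

  data Gadget : GVertex n → Set where
    x : ∀ l → Gadget (x l)
    y : ∀ l → Gadget (y l)
    z : ∀ l → Gadget (z l)

  gadget-rank : ∀ {w} → Gadget w → ∃[ j ] rank w ≡ suc (suc j)
  gadget-rank (x l) = toℕ l , refl
  gadget-rank (y l) = toℕ l , refl
  gadget-rank (z l) = toℕ l , refl

  -- `x l` and `z l` are not adjacent, so each leaves the other as a witness. `y l` dominates its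
  -- whole gadget, and the witness is the spine vertex at its subscript.
  reply-to-gadget-legal : ∀ {w k} → Gadget w → toℕ k ≡ rank w → Legal (w ∷ []) (u k)
  reply-to-gadget-legal (x l) e =
    (z l , inj₂ (fwd (u⁺z e)) , λ { (here (inj₂ (fwd ()))) ; (here (inj₂ (bwd ()))) }) ,
    inj₂ (here (fwd (u⁺x e)))
  reply-to-gadget-legal (y l) e =
    let l<1+n = <-trans (n<1+n _) (gadget-below l)
        e′    = toℕ-fromℕ< l<1+n
    in (u (fromℕ< l<1+n) , inj₂ (bwd (uu (trans e (cong suc (sym e′))))) ,
        λ { (here (inj₂ (bwd (u⁺y e″)))) → 1+n≢n (trans (sym e″) e′) }) ,
       inj₂ (here (fwd (u⁺y e)))
  reply-to-gadget-legal (z l) e =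
    (x l , inj₂ (fwd (u⁺x e)) , λ { (here (inj₂ (fwd ()))) ; (here (inj₂ (bwd ()))) }) ,
    inj₂ (here (fwd (u⁺z e)))

  lower-bound : ∀ m {e} → suc m ≡ n → 2 ≤ n → suc m * 2 ≤ movesLeft (suc m * 2 + e) staller []
  lower-bound m {e} 1+m≡n 2≤n = staller-plays (suc (m * 2 + e)) ((u zero , inj₁ refl , λ ()) , inj₁ refl)
    (all-replies-≥ (m * 2 + e) (second-move-legal 2≤n (proj₂ (fin-u 1+m≡n)))
      λ legal → respond (legal-moves (Span-singleton zero) refl legal))
    where
    respond : ∀ {w} → Frontier 0 0 w → m * 2 ≤ movesLeft (m * 2 + e) staller (w ∷ u zero ∷ [])
    -- The other frontier moves are void here: no rank lies below 0 and no subscript is 0.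
    respond (right k≡1) = lower-staller m (extend-right [] [] k≡1 (Span-singleton zero)) 1+m≡n

  upper-bound : ∀ f → 2 ≤ n → movesLeft f staller [] ≤ n * 2
  upper-bound zero    2≤n = z≤n
  upper-bound (suc f) 2≤n = all-replies-≤ f λ {w} _ → opening w
    where
    -- With `i + m ≡ n`, the bound `m * 2 + i` is `i` short of `n * 2`, which pays for up to `i`
    -- opening moves.
    slack : ∀ c {i m} → i + m ≡ n → c ≤ i → c + (m * 2 + i) ≤ n * 2
    slack c {i} {m} i+m≡n c≤i = begin
      c + (m * 2 + i)  ≤⟨ +-monoˡ-≤ (m * 2 + i) c≤i ⟩
      i + (m * 2 + i)  ≡⟨ solve 2 (λ i m → i :+ (m :* con 2 :+ i) := (i :+ m) :* con 2) refl i m ⟩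
      (i + m) * 2      ≡⟨ cong (_* 2) i+m≡n ⟩
      n * 2            ∎
      where open ≤-Reasoning

    1≤n = ≤-trans (s≤s z≤n) 2≤n

    -- A span starting at rank 0 has no slack, so Dominator's answer `u 1` is counted explicitly:
    -- two moves plus `m * 2` is exactly `n * 2`.
    after-end : ∀ f → movesLeft f dominator (u zero ∷ []) < n * 2
    after-end zero    = ≤-trans 1≤n (m≤m*n n 2)
    after-end (suc f) =
      let m , 1+m≡n = m≤n⇒∃[o]m+o≡n 1≤n
          _ , e     = fin-u 1+m≡n
          σ         = extend-right [] [] e (Span-singleton zero)
      in ≤-trans (s≤s (dominator-plays f (second-move-legal 2≤n e) (upper-staller f m σ 1+m≡n)))
           (≤-trans (≤-reflexive (cong suc (sym (+-suc (m * 2) 0)))) (slack 1 1+m≡n ≤-refl))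

    after-gadget : ∀ f {w} → Gadget w → movesLeft f dominator (w ∷ []) < n * 2
    after-gadget zero    g = ≤-trans 1≤n (m≤m*n n 2)
    after-gadget (suc f) {w} g =
      let _ , w≡    = gadget-rank g
          k , e     = spine-vertex w
          k≡        = trans e w≡
          m , k+m≡n = m≤n⇒∃[o]m+o≡n (subst (_≤ n) k≡ (toℕ≤pred[n] k))
      in ≤-trans (s≤s (dominator-plays f (reply-to-gadget-legal g e) (upper-staller f m (Span-pair k≡ w≡) k+m≡n)))
           -- Two moves, the opening and its answer, are covered because a gadget vertex has rank at
           -- least 2.
           (slack 2 k+m≡n (s≤s (s≤s z≤n)))

    opening : ∀ w → movesLeft f dominator (w ∷ []) < n * 2
    opening (u zero)    = after-end f
    opening (u (suc k)) =
      let m , k+m≡n = m≤n⇒∃[o]m+o≡n (toℕ≤pred[n] (suc k))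
      in ≤-trans
           (s≤s (≤-trans (upper-dominator f m (Span-singleton (suc k)) k+m≡n)
             (+-monoˡ-≤ (toℕ (suc k)) (m∸n≤m (m * 2) 1))))
           (slack 1 k+m≡n (s≤s z≤n))
    opening (x l) = after-gadget f (x l)
    opening (y l) = after-gadget f (y l)
    opening (z l) = after-gadget f (z l)

-- Sufficient fuel, and the value of the game.

length-map-allFin : ∀ {A : Set} m (f : Fin m → A) → length (map f (allFin m)) ≡ m
length-map-allFin m f = trans (length-map f (allFin m)) (length-tabulate id)

-- The game is run with as much fuel as there are vertices, and the lower bound needs `n * 2`. The
-- `u` and `x` vertices alone number `(n + 1) + (n - 1)`.
n*2≤∣Gₙ∣ : ∀ n → 2 ≤ n → n * 2 ≤ length (vertexList n)
n*2≤∣Gₙ∣ (suc zero) (s≤s ())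
n*2≤∣Gₙ∣ n@(suc m@(suc k)) _ = begin
  n * 2                                        ≡⟨ solve 1 (λ k → (con 2 :+ k) :* con 2 := con 3 :+ k :+ (con 1 :+ k)) refl k ⟩
  suc n + m                                    ≤⟨ +-monoʳ-≤ (suc n) (m≤m+n m (m + m)) ⟩
  suc n + (m + (m + m))                        ≡⟨ cong₂ _+_ (length-map-allFin (suc n) u) (cong₂ _+_ (length-map-allFin m x)
                                                   (cong₂ _+_ (length-map-allFin m y) (length-map-allFin m z))) ⟨
  length us + (length xs + (length ys + length zs)) ≡⟨ cong (length us +_) (cong (length xs +_) (length-++ ys)) ⟨
  length us + (length xs + length (ys ++ zs))  ≡⟨ cong (length us +_) (length-++ xs) ⟨
  length us + length (xs ++ ys ++ zs)          ≡⟨ length-++ us ⟨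
  length (vertexList n)                        ∎
  where
  open ≤-Reasoning
  us = map (u {n}) (allFin (suc n))
  xs = map (x {n}) (allFin m)
  ys = map (y {n}) (allFin m)
  zs = map (z {n}) (allFin m)

lemma3p4 : ∀ (n : ℕ) → 2 ≤ n → γcg′ (Gₙ n) ≡ 2 * n
lemma3p4 n@(suc m) 2≤n = trans (≤-antisym (upper-bound (length (vertexList n)) 2≤n) lower) (*-comm n 2)
  where
  open ConnectedDominationGame (Gₙ n) using (movesLeft)
  lower : n * 2 ≤ γcg′ (Gₙ n)
  lower =
    let _ , eq = m≤n⇒∃[o]m+o≡n (n*2≤∣Gₙ∣ n 2≤n)
    in subst (λ f → n * 2 ≤ movesLeft f staller []) eq (lower-bound m refl 2≤n)
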